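{- Let $H$ be a connected graph of order $p \geq 4$ with cyclomatic number $v(H) \geq 2$. Then $rb(K_n, H)$ cannot be bounded from above by a function which is linear in $n$; that is, there are no constants $a, b$ such that $rb(K_n,H) \leq an + b$ for all $n \geq p$.
   Context: For a graph $H$ and an integer $n$, the rainbow number $rb(K_n,H)$ is the minimum number $m$ such that every edge-colouring of the complete graph $K_n$ using at least $m$ colours contains a rainbow (totally multicoloured) copy of $H$, i.e. a subgraph isomorphic to $H$ whose edges all have distinct colours. Equivalently $rb(K_n,H) = f(n,H)+1$, where $f(n,H)$ is the maximum number of colours in an edge-colouring of $K_n$ with no rainbow copy of $H$. The cyclomatic number of a connected graph $G$ is $v(G) = |E(G)| - |V(G)| + 1$. -}

module Defs where

open import Data.Nat using (ℕ; zero; suc; _+_; _*_; _≤_; _<_; _<ᵇ_)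
open import Data.Integer as ℤ using (ℤ; +_)
open import Data.Fin using (Fin; toℕ)
open import Data.Bool using (Bool; true; false; _∧_)
open import Data.List using (List; []; _∷_; length; filter; concatMap; allFin)
open import Data.Product using (Σ; _×_; _,_; ∃)
open import Data.Sum using (_⊎_)
open import Relation.Binary.PropositionalEquality using (_≡_)
open import Relation.Nullary using (¬_)
open import Function.Definitions using (Injective)

record Graph : Set where
  field
    order : ℕ
    adj   : Fin order → Fin order → Bool
    sym   : ∀ u v → adj u v ≡ adj v u
    irrefl : ∀ u → adj u u ≡ false

open Graph public

data Walk (G : Graph) : Fin (order G) → Fin (order G) → Set where
  here : ∀ {u} → Walk G u u
  step : ∀ {u v w} → adj G u v ≡ true → Walk G v w → Walk G u w

Connected : Graph → Set
Connected G = ∀ u v → Walk G u v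

edges : (G : Graph) → List (Fin (order G) × Fin (order G))
edges G = concatMap (λ u → concatMap (λ v → row u v) (allFin (order G)))
                    (allFin (order G))
  where
  row : Fin (order G) → Fin (order G) → List (Fin (order G) × Fin (order G))
  row u v with (toℕ u <ᵇ toℕ v) ∧ adj G u v
  ... | true  = (u , v) ∷ []
  ... | false = []

numEdges : Graph → ℕ
numEdges G = length (edges G)

cyclomatic : Graph → ℤ
cyclomatic G = (+ numEdges G ℤ.- + order G) ℤ.+ + 1

-- Edge-colourings of K_n (colours are natural numbers; the diagonal is
-- irrelevant since K_n has no loops)

record Colouring (n : ℕ) : Set where
  field
    col    : Fin n → Fin n → ℕ
    colSym : ∀ i j → col i j ≡ col j i

open Colouring public

AtLeastColours : ∀ {n} → Colouring n → ℕ → Set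
AtLeastColours {n} c m =
  Σ (Fin m → Fin n × Fin n) λ e →
    (∀ k → let (i , j) = e k in ¬ i ≡ j) ×
    (∀ k l → (let (i , j) = e k ; (i' , j') = e l in col c i j ≡ col c i' j') → k ≡ l)

RainbowCopy : (H : Graph) → ∀ {n} → Colouring n → Set
RainbowCopy H {n} c =
  Σ (Fin (order H) → Fin n) λ f →
    Injective _≡_ _≡_ f ×
    (∀ u v u' v' → adj H u v ≡ true → adj H u' v' ≡ true →
       col c (f u) (f v) ≡ col c (f u') (f v') →
       (u ≡ u' × v ≡ v') ⊎ (u ≡ v' × v ≡ u'))

Forces : Graph → ℕ → ℕ → Set
Forces H n m = (c : Colouring n) → AtLeastColours c m → RainbowCopy H c

IsRb : Graph → ℕ → ℕ → Set
IsRb H n m = Forces H n m × (∀ k → Forces H n k → m ≤ k)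

{-# OPTIONS --safe #-}
-- It suffices to colour K_n so that the graph G of its non-zero colour classes is rainbow, has at
-- least an + b edges and has girth above p = |H|: a rainbow copy of H has at most one edge of colour
-- 0, so it places at least p edges of G on p vertices, hence a cycle of length at most p in G.
--
-- Such a G is the graph of d involutions on a finite set whose short reduced words act without
-- fixed points. To lengthen the words, pass to the cover that records in one bit per edge the parity
-- of the number of times this edge has been crossed: a shortest closed reduced walk crosses its
-- first edge only once, so it does not close up in the cover.
module Submission where

open import Defs
open import Data.Nat using (ℕ; _+_; _*_; _≤_)
open import Data.Integer using (+_) renaming (_≤_ to _≤ℤ_)
open import Data.Product using (Σ; _×_)
open import Relation.Nullary using (¬_)

open import Data.Bool using (Bool; true; false; _∧_; not; if_then_else_; T)
import Data.Bool.Properties as Bool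
open import Data.Fin as Fin using
  (Fin; zero; suc; toℕ; punchIn; combine; remQuot; finToFun; funToFin; splitAt; _↑ˡ_; _↑ʳ_)
import Data.Fin.Properties as Fin
import Data.Integer as ℤ
import Data.Integer.Properties as ℤ
import Data.Integer.Tactic.RingSolver as ℤ-Ring
open import Data.List using (length; tabulate; concatMap; allFin; List)
import Data.List.Properties as List
open import Data.Nat using (zero; suc; _<_; _^_; z≤n; s≤s; NonZero; >-nonZero; _<ᵇ_; _≡ᵇ_)
open import Data.Nat.Induction using (<-rec)
open import Data.Nat.Properties
import Data.Nat.Tactic.RingSolver as ℕ-Ring
open import Algebra.Properties.CommutativeMonoid.Sum +-0-commutativeMonoid
  using (sum; sum-remove; ∑-distrib-+; sum-cong-≗; sum-replicate-zero)
open import Data.Product using (_,_; proj₁; proj₂; ∃)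
open import Data.Sum using (_⊎_; inj₁; inj₂; [_,_]′)
open import Data.Vec.Functional using (updateAt)
open import Data.Vec.Functional.Properties using (updateAt-updates; updateAt-minimal)
open import Function using (_∘_; id; const)
open import Function.Definitions using (Injective)
open import Relation.Binary.PropositionalEquality
  using (_≡_; _≢_; refl; trans; cong; cong₂; subst) renaming (sym to ≡-sym)
open import Relation.Nullary using (Dec; yes; no; contradiction)
open import Relation.Nullary.Decidable using (_×-dec_; _⊎-dec_; ¬?)

-- Involutions, reduced walks and girth

private
  variable
    X Y : Set
    d n : ℕ

-- An action of the free product of `d` groups of order two, read as a graph whose edges join `x` to
-- `act i x`. Fixed points and coinciding involutions are permitted here; girth conditions will
-- exclude them.
record Involutions (X : Set) (d : ℕ) : Set where
  field
    act        : Fin d → X → X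
    involutive : ∀ i x → act i (act i x) ≡ x

open Involutions

-- Walks are endless so that shifts and images need no lengths; `GirthAbove` inspects only an
-- initial segment.
record ReducedWalk (A : Involutions X d) : Set where
  field
    vertex  : ℕ → X
    label   : ℕ → Fin d
    reduced : ∀ m → label m ≢ label (suc m)
    follows : ∀ m → vertex (suc m) ≡ act A (label m) (vertex m)

open ReducedWalk

-- The closed lengths excluded are 1 to `k`. For `d` at least 2, a fixed point counts as a cycle of
-- length 1, and two involutions agreeing at a point as one of length 2.
GirthAbove : Involutions X d → ℕ → Set
GirthAbove A k = (w : ReducedWalk A) → ∀ {m} → m < k → vertex w 0 ≢ vertex w (suc m)

dropSteps : {A : Involutions X d} → ℕ → ReducedWalk A → ReducedWalk A
dropSteps l w = record
  { vertex  = λ m → vertex w (m + l)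
  ; label   = λ m → label w (m + l)
  ; reduced = λ m → reduced w (m + l)
  ; follows = λ m → follows w (m + l)
  }

Equivariant : Involutions X d → Involutions Y d → (X → Y) → Set
Equivariant A B φ = ∀ i x → φ (act A i x) ≡ act B i (φ x)

mapWalk : {A : Involutions X d} {B : Involutions Y d} {φ : X → Y} →
          Equivariant A B φ → ReducedWalk A → ReducedWalk B
mapWalk {φ = φ} eqv w = record
  { vertex  = φ ∘ vertex w
  ; label   = label w
  ; reduced = reduced w
  ; follows = λ m → trans (cong φ (follows w m)) (eqv _ _)
  }

-- An equivariant map preserves labels, so the image of a closed reduced walk is again closed and
-- reduced, even if `φ` is not injective.
girthAbove-pullback : {A : Involutions X d} {B : Involutions Y d} {φ : X → Y} →
                      Equivariant A B φ → ∀ {k} → GirthAbove B k → GirthAbove A k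
girthAbove-pullback {A = A} {B} {φ} eqv girth w m<k eq =
  girth (mapWalk {A = A} {B} eqv w) m<k (cong φ eq)

girthAbove-mono : {A : Involutions X d} → ∀ {k l} → l ≤ k → GirthAbove A k → GirthAbove A l
girthAbove-mono l≤k girth w m<l = girth w (<-≤-trans m<l l≤k)

-- If i ≢ j, the walk with alternating labels i, j from act i x returns after two steps.
act-injective : (A : Involutions X d) → ∀ {k} → 2 ≤ k → GirthAbove A k →
                ∀ x {i j} → act A i x ≡ act A j x → i ≡ j
act-injective {X} {d} A 2≤k girth x {i} {j} eq with i Fin.≟ j
... | yes i≡j = i≡j
... | no  i≢j = contradiction
      (trans eq (cong (act A j) (≡-sym (involutive A i x)))) (girth alternating 2≤k)
  where
  lab : ℕ → Fin d
  lab 0 = i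
  lab 1 = j
  lab (suc (suc m)) = lab m
  lab-reduced : ∀ m → lab m ≢ lab (suc m)
  lab-reduced 0 = i≢j
  lab-reduced 1 = i≢j ∘ ≡-sym
  lab-reduced (suc (suc m)) = lab-reduced m
  vert : ℕ → X
  vert 0 = act A i x
  vert (suc m) = act A (lab m) (vert m)
  alternating : ReducedWalk A
  alternating = record
    { vertex = vert ; label = lab ; reduced = lab-reduced ; follows = λ _ → refl }

-- The parity cover

funToFin-cong : ∀ {m n} {f g : Fin m → Fin n} → (∀ i → f i ≡ g i) → funToFin f ≡ funToFin g
funToFin-cong {zero}  f≗g = refl
funToFin-cong {suc m} f≗g = cong₂ combine (f≗g zero) (funToFin-cong (f≗g ∘ suc))

-- Bit vectors are coded as numbers: unlike functions they then have extensional equality, and the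
-- cover stays finite of known size.
bit : ∀ {m} → Fin (2 ^ m) → Fin m → Fin 2
bit {m} = finToFun {2} {m}

bit-ext : ∀ {m} {y z : Fin (2 ^ m)} → (∀ i → bit y i ≡ bit z i) → y ≡ z
bit-ext {m} {y} {z} eq = trans (≡-sym (Fin.funToFin-finToFin {m} {2} y))
  (trans (funToFin-cong {m} {2} eq) (Fin.funToFin-finToFin {m} {2} z))

toggle : ∀ {m} → Fin m → Fin (2 ^ m) → Fin (2 ^ m)
toggle j y = funToFin (updateAt (bit y) j Fin.opposite)

bit-toggle : ∀ {m} (j : Fin m) y → bit (toggle j y) j ≡ Fin.opposite (bit y j)
bit-toggle j y = trans (Fin.finToFun-funToFin _ j) (updateAt-updates j (bit y))

bit-toggle-≢ : ∀ {m} {i j : Fin m} y → i ≢ j → bit (toggle j y) i ≡ bit y i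
bit-toggle-≢ {i = i} {j} y i≢j = trans (Fin.finToFun-funToFin _ i) (updateAt-minimal i j (bit y) i≢j)

toggle-involutive : ∀ {m} (j : Fin m) y → toggle j (toggle j y) ≡ y
toggle-involutive {m} j y = bit-ext {m} eq
  where
  eq : ∀ i → bit {m} (toggle j (toggle j y)) i ≡ bit {m} y i
  eq i with i Fin.≟ j
  ... | yes refl = trans (bit-toggle i (toggle i y))
                     (trans (cong Fin.opposite (bit-toggle i y)) (Fin.opposite-involutive (bit y i)))
  ... | no  i≢j  = trans (bit-toggle-≢ (toggle j y) i≢j) (bit-toggle-≢ y i≢j)

opposite-irrefl : ∀ (b : Fin 2) → b ≢ Fin.opposite b
opposite-irrefl zero ()
opposite-irrefl (suc zero) ()

module _ {n : ℕ} where
  open import Algebra.Construct.NaturalChoice.Min (Fin.≤-totalOrder n) public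
    using () renaming (_⊓_ to _⊓ᶠ_; ⊓-sel to ⊓ᶠ-sel; ⊓-comm to ⊓ᶠ-comm)

module Cover {n d : ℕ} (A : Involutions (Fin n) d) where

  -- The lesser end of the edge, a name that does not depend on the end from which the edge is
  -- crossed.
  representative : Fin d → Fin n → Fin n
  representative i v = v ⊓ᶠ act A i v

  representative-act : ∀ i v → representative i (act A i v) ≡ representative i v
  representative-act i v =
    trans (cong (act A i v ⊓ᶠ_) (involutive A i v)) (⊓ᶠ-comm (act A i v) v)

  representative-injective : ∀ i u v → representative i u ≡ representative i v →
                             u ≡ v ⊎ u ≡ act A i v
  representative-injective i u v eq with ⊓ᶠ-sel u (act A i u) | ⊓ᶠ-sel v (act A i v)
  ... | inj₁ p | inj₁ q = inj₁ (trans (≡-sym p) (trans eq q))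
  ... | inj₁ p | inj₂ q = inj₂ (trans (≡-sym p) (trans eq q))
  ... | inj₂ p | inj₁ q = inj₂ (trans (≡-sym (involutive A i u))
                                 (cong (act A i) (trans (≡-sym p) (trans eq q))))
  ... | inj₂ p | inj₂ q = inj₁ (trans (≡-sym (involutive A i u))
                                 (trans (cong (act A i) (trans (≡-sym p) (trans eq q)))
                                        (involutive A i v)))

  -- Indices whose vertex is not a lesser end name no edge; their bits never change.
  edge : Fin d → Fin n → Fin (n * d)
  edge i v = combine (representative i v) i

  edge-act : ∀ i v → edge i (act A i v) ≡ edge i v
  edge-act i v = cong (λ r → combine r i) (representative-act i v)

  cover : Involutions (Fin n × Fin (2 ^ (n * d))) d
  cover = record
    { act        = λ i (v , y) → act A i v , toggle (edge i v) y
    -- Going and returning toggle the same bit, by `edge-act`.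
    ; involutive = λ i (v , y) → cong₂ _,_ (involutive A i v)
        (trans (cong (λ e → toggle e (toggle (edge i v) y)) (edge-act i v))
               (toggle-involutive (edge i v) y))
    }

  -- A second crossing would start at one of the two ends of the first edge. At the initial end the
  -- walk has closed up in `suc j` steps. At the other end, either `j` is zero and the equal labels
  -- contradict reducedness, or the walk without its first step closes up in `j` steps.
  first-edge-crossed-once : ∀ {k} → GirthAbove A k → (w : ReducedWalk A) → ∀ {j} → j < k →
    edge (label w 0) (vertex w 0) ≢ edge (label w (suc j)) (vertex w (suc j))
  first-edge-crossed-once {k} girth w {j} j<k eq =
      [ girth w j<k ∘ ≡-sym , second-vertex j<k sameLabel ]′
        (representative-injective (label w 0) _ _
          (trans (cong (λ c → representative c (vertex w (suc j))) sameLabel) (≡-sym sameRep)))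
    where
    inj       = Fin.combine-injective (representative (label w 0) (vertex w 0)) (label w 0) _ _ eq
    sameRep   = proj₁ inj
    sameLabel = proj₂ inj
    second-vertex : ∀ {j} → j < k → label w 0 ≡ label w (suc j) →
                    vertex w (suc j) ≢ act A (label w 0) (vertex w 0)
    second-vertex {zero}  _   sameLabel _ = reduced w 0 sameLabel
    second-vertex {suc j} j<k _ returns =
      girth (dropSteps 1 w) (<-trans (n<1+n j) j<k)
        (trans (follows w 0) (trans (≡-sym returns) (cong (vertex w) (+-comm 1 (suc j)))))

  -- Closed walks of at most `k` steps are excluded by projection to `A`. In a walk of `suc k` steps
  -- only the first step toggles the bit of the first edge, so that bit ends up flipped.
  cover-girthAbove : ∀ {k} → GirthAbove A k → GirthAbove cover (suc k)
  cover-girthAbove {k} girth w {m} (s≤s m≤k) closed with m≤n⇒m<n∨m≡n m≤k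
  ... | inj₁ m<k  = girthAbove-pullback {A = cover} {A} {proj₁} (λ _ _ → refl) girth w m<k closed
  ... | inj₂ refl = opposite-irrefl _
          (trans (cong (λ x → bit (proj₂ x) first) closed) (flipped m ≤-refl))
    where
    w′ : ReducedWalk A
    w′ = mapWalk {A = cover} {A} {proj₁} (λ _ _ → refl) w
    first : Fin (n * d)
    first = edge (label w′ 0) (vertex w′ 0)
    parity : ℕ → Fin 2
    parity m = bit (proj₂ (vertex w m)) first
    flipped : ∀ j → j ≤ k → parity (suc j) ≡ Fin.opposite (parity 0)
    flipped zero    _   = trans (cong (λ x → bit (proj₂ x) first) (follows w 0))
                            (bit-toggle first (proj₂ (vertex w 0)))
    flipped (suc j) j<k = trans (cong (λ x → bit (proj₂ x) first) (follows w (suc j)))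
      (trans (bit-toggle-≢ (proj₂ (vertex w (suc j))) (first-edge-crossed-once girth w′ j<k))
             (flipped j (<⇒≤ j<k)))

open Cover using (cover; cover-girthAbove)

-- Returns the cover to a set of the form `Fin n`, so that the construction can be iterated.
encode : ∀ {m n d} → Involutions (Fin m × Fin n) d → Involutions (Fin (m * n)) d
encode {m} {n} A = record
  { act        = λ i x → code (act A i (remQuot n x))
  ; involutive = λ i x → trans
      (cong (code ∘ act A i) (Fin.remQuot-combine _ _))
      (trans (cong code (involutive A i (remQuot n x))) (Fin.combine-remQuot {m} n x))
  }
  where
  code : Fin m × Fin n → Fin (m * n)
  code (v , y) = combine v y

large-girth : ∀ k d s → .{{NonZero s}} →
              ∃ λ n → s ≤ n × Σ (Involutions (Fin n) d) λ A → GirthAbove A k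
-- Girth above 0 is no condition, so trivial involutions start the tower.
large-girth zero    d s = s , ≤-refl , record { act = const id ; involutive = λ _ _ → refl } , λ _ ()
large-girth (suc k) d s with large-girth k d s
... | n , s≤n , A , girth = n * 2 ^ (n * d)
    , ≤-trans s≤n (m≤m*n n (2 ^ (n * d)) {{m^n≢0 2 (n * d)}})
    , encode (cover A)
    , girthAbove-pullback {A = encode (cover A)} {cover A} {remQuot _}
        (λ i x → Fin.remQuot-combine _ _) (cover-girthAbove A girth)

-- Sums and edge counts

sum-mono-≤ : {s t : Fin n → ℕ} → (∀ i → s i ≤ t i) → sum s ≤ sum t
sum-mono-≤ {zero}  s≤t = z≤n
sum-mono-≤ {suc n} s≤t = +-mono-≤ (s≤t zero) (sum-mono-≤ (s≤t ∘ suc))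

sum-mono-≤-except : {s t : Fin n → ℕ} (x : Fin n) → s x ≤ suc (t x) →
                    (∀ i → i ≢ x → s i ≤ t i) → sum s ≤ suc (sum t)
sum-mono-≤-except {suc n} {s} {t} x at-x elsewhere = begin
  sum s                            ≡⟨ sum-remove {i = x} s ⟩
  s x + sum (s ∘ punchIn x)        ≤⟨ +-mono-≤ at-x (sum-mono-≤ λ i → elsewhere _ (Fin.punchInᵢ≢i x i)) ⟩
  suc (t x + sum (t ∘ punchIn x))  ≡⟨ cong suc (≡-sym (sum-remove {i = x} t)) ⟩
  suc (sum t)                      ∎
  where open ≤-Reasoning

indicator : Bool → ℕ
indicator b = if b then 1 else 0

indicator-false : ∀ {b} → b ≢ true → indicator b ≡ 0
indicator-false {true}  b≢true = contradiction refl b≢true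
indicator-false {false} _      = refl

indicator-mono : ∀ {b c} → (b ≡ true → c ≡ true) → indicator b ≤ indicator c
indicator-mono {false} _   = z≤n
indicator-mono {true}  b⇒c rewrite b⇒c refl = ≤-refl

indicator≤1 : ∀ b → indicator b ≤ 1
indicator≤1 true  = ≤-refl
indicator≤1 false = z≤n

Digraph : ℕ → Set
Digraph n = Fin n → Fin n → Bool

arcs : Digraph n → ℕ
arcs T = sum λ u → sum λ v → indicator (T u v)

-- The case of equal `u` and `v` excludes loops, so `arcs` counts each edge of a simple graph once.
Oriented : Digraph n → Set
Oriented T = ∀ u v → T u v ≡ true → T v u ≢ true

Joined : Digraph n → Fin n → Fin n → Set
Joined T u v = T u v ≡ true ⊎ T v u ≡ true

joined? : (T : Digraph n) → ∀ u v → Dec (Joined T u v)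
joined? T u v = (T u v Bool.≟ true) ⊎-dec (T v u Bool.≟ true)

delete : Fin (suc n) → Digraph (suc n) → Digraph n
delete x T u v = T (punchIn x u) (punchIn x v)

-- Only an inequality, since a loop at `x` is counted twice on the right.
arcs-delete : (T : Digraph (suc n)) (x : Fin (suc n)) →
              arcs T ≤ sum (λ v → indicator (T x v) + indicator (T v x)) + arcs (delete x T)
arcs-delete T x = begin
  arcs T
    ≡⟨ sum-remove {i = x} (sum ∘ t) ⟩
  out + sum (λ u → sum (t (punchIn x u)))
    ≡⟨ cong (λ r → out + r) (sum-cong-≗ λ u → sum-remove {i = x} (t (punchIn x u))) ⟩
  out + sum (λ u → t (punchIn x u) x + sum (t (punchIn x u) ∘ punchIn x))
    ≡⟨ cong (λ r → out + r) (∑-distrib-+ (λ u → t (punchIn x u) x) (λ u → sum (t (punchIn x u) ∘ punchIn x))) ⟩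
  out + (sum (λ u → t (punchIn x u) x) + arcs (delete x T))
    ≤⟨ +-monoʳ-≤ out (+-monoˡ-≤ (arcs (delete x T)) (m≤n+m _ (t x x))) ⟩
  out + (t x x + sum (λ u → t (punchIn x u) x) + arcs (delete x T))
    ≡⟨ cong (λ s → out + (s + arcs (delete x T))) (≡-sym (sum-remove {i = x} λ u → t u x)) ⟩
  out + (sum (λ u → t u x) + arcs (delete x T))
    ≡⟨ ≡-sym (+-assoc out _ _) ⟩
  out + sum (λ u → t u x) + arcs (delete x T)
    ≡⟨ cong (λ r → r + arcs (delete x T)) (≡-sym (∑-distrib-+ (t x) λ v → t v x)) ⟩
  sum (λ v → t x v + t v x) + arcs (delete x T) ∎
  where
  open ≤-Reasoning
  t : Fin _ → Fin _ → ℕ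
  t u v = indicator (T u v)
  out : ℕ
  out = sum (t x)

-- Only `y` can contribute, and orientedness allows one direction. Isolated vertices are covered
-- too, as `y` need not be a neighbour.
leaf-degree : (T : Digraph n) → Oriented T → ∀ x y → (∀ z → z ≢ y → ¬ Joined T x z) →
              sum (λ v → indicator (T x v) + indicator (T v x)) ≤ 1
leaf-degree {n} T oriented x y isolated = ≤-trans
  (sum-mono-≤-except y at-y elsewhere)
  (≤-reflexive (cong suc (sum-replicate-zero n)))
  where
  elsewhere : ∀ z → z ≢ y → indicator (T x z) + indicator (T z x) ≤ 0
  elsewhere z z≢y = ≤-reflexive (cong₂ _+_ (indicator-false (isolated z z≢y ∘ inj₁))
                                           (indicator-false (isolated z z≢y ∘ inj₂)))
  at-y : indicator (T x y) + indicator (T y x) ≤ 1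
  at-y with T x y in eq
  ... | true  = s≤s (≤-reflexive (indicator-false (oriented x y eq)))
  ... | false = indicator≤1 (T y x)

-- Meant for `R` consisting of the arcs of non-zero colour: in a rainbow copy at most one arc has
-- colour 0.
delete-arc : (T R : Digraph n) →
             (∀ {u v u′ v′} → T u v ≡ true → R u v ≢ true → T u′ v′ ≡ true → R u′ v′ ≢ true →
               u ≡ u′ × v ≡ v′) →
             arcs T ≤ suc (arcs R)
delete-arc {n} T R unique
  with Fin.any? (λ u → Fin.any? λ v → (T u v Bool.≟ true) ×-dec ¬? (R u v Bool.≟ true))
... | no none = m≤n⇒m≤1+n (sum-mono-≤ λ u → sum-mono-≤ λ v → indicator-mono (T⇒R u v))
  where
  T⇒R : ∀ u v → T u v ≡ true → R u v ≡ true
  T⇒R u v Tuv with R u v Bool.≟ true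
  ... | yes Ruv = Ruv
  ... | no ¬Ruv = contradiction (u , v , Tuv , ¬Ruv) none
... | yes (u₀ , v₀ , T₀ , ¬R₀) = sum-mono-≤-except u₀
    (sum-mono-≤-except v₀ (≤-trans (indicator≤1 _) (s≤s z≤n))
      λ v v≢ → indicator-mono (T⇒R u₀ v (v≢ ∘ proj₂)))
    λ u u≢ → sum-mono-≤ λ v → indicator-mono (T⇒R u v (u≢ ∘ proj₁))
  where
  T⇒R : ∀ u v → ¬ (u ≡ u₀ × v ≡ v₀) → T u v ≡ true → R u v ≡ true
  T⇒R u v ≢₀ Tuv with R u v Bool.≟ true
  ... | yes Ruv = Ruv
  ... | no ¬Ruv = contradiction (unique Tuv ¬Ruv T₀ ¬R₀) ≢₀

-- Sparsity of small subgraphs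

module _ (A : Involutions X d) where

  Adjacent : X → X → Set
  Adjacent x y = ∃ λ i → act A i x ≡ y

  adjacent-sym : ∀ {x y} → Adjacent x y → Adjacent y x
  adjacent-sym {x} (i , refl) = i , involutive A i x

  -- A graph without leaves carries an endless non-backtracking walk, and its first repetition is a
  -- reduced walk that closes up within suc q steps.
  some-leaf : ∀ {q} → GirthAbove A (suc q) → (f : Fin (suc q) → X) → Injective _≡_ _≡_ f →
              (_~_ : Fin (suc q) → Fin (suc q) → Set) → (∀ {u v} → u ~ v → Adjacent (f u) (f v)) →
              ¬ (∀ x y → ∃ λ z → z ≢ y × x ~ z)
  some-leaf {q} girth f f-inj _~_ embeds onward = noRepeat (Fin.pigeonhole (n<1+n (suc q)) (s ∘ toℕ))
    where
    s : ℕ → Fin (suc q)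
    s 0 = zero
    -- No vertex precedes the start, so the vertex to avoid is an arbitrary choice.
    s 1 = proj₁ (onward zero zero)
    s (suc (suc m)) = proj₁ (onward (s (suc m)) (s m))
    s-adj : ∀ m → Adjacent (f (s m)) (f (s (suc m)))
    s-adj 0 = embeds (proj₂ (proj₂ (onward zero zero)))
    s-adj (suc m) = embeds (proj₂ (proj₂ (onward (s (suc m)) (s m))))
    s-nonbacktracking : ∀ m → s (suc (suc m)) ≢ s m
    s-nonbacktracking m = proj₁ (proj₂ (onward (s (suc m)) (s m)))
    w : ReducedWalk A
    w = record
      { vertex  = f ∘ s
      ; label   = proj₁ ∘ s-adj
      -- Two equal consecutive labels would undo each other and lead back to `s m`.
      ; reduced = λ m eq → s-nonbacktracking m (f-inj (≡-sym
          (trans (≡-sym (involutive A (proj₁ (s-adj m)) _))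
            (trans (cong (act A (proj₁ (s-adj m))) (proj₂ (s-adj m)))
              (trans (cong (λ i → act A i (f (s (suc m)))) eq) (proj₂ (s-adj (suc m))))))))
      ; follows = λ m → ≡-sym (proj₂ (s-adj m))
      }
    noRepeat : ¬ (∃ λ i → ∃ λ j → i Fin.< j × s (toℕ i) ≡ s (toℕ j))
    noRepeat (i , j , i<j , si≡sj) with m≤n⇒∃[o]m+o≡n i<j
    ... | o , i+o≡j = girth (dropSteps (toℕ i) w) o<1+q
            (trans (cong f si≡sj) (cong (f ∘ s) (trans (≡-sym i+o≡j) (cong suc (+-comm (toℕ i) o)))))
      where
      o<1+q : o < suc q
      o<1+q = ≤-trans (s≤s (m≤n+m o (toℕ i))) (≤-trans (≤-reflexive i+o≡j) (Fin.toℕ≤pred[n] j))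

  -- Induction on the number of vertices: `some-leaf` rules out that every vertex has two
  -- neighbours, and deleting a vertex with at most one costs at most one arc.
  forest : ∀ q → GirthAbove A (suc q) → (f : Fin (suc q) → X) → Injective _≡_ _≡_ f →
           (T : Digraph (suc q)) → Oriented T → (∀ {u v} → T u v ≡ true → Adjacent (f u) (f v)) →
           arcs T ≤ q
  forest zero girth f f-inj T oriented embeds
    with T zero zero in eq
  ... | true  = contradiction eq (oriented zero zero eq)
  ... | false = z≤n
  forest (suc q) girth f f-inj T oriented embeds
    with Fin.any? (λ x → Fin.any? λ y → Fin.all? λ z → ¬? (¬? (z Fin.≟ y) ×-dec joined? T x z))
  ... | yes (x , y , isolated) = begin
      arcs T
        ≤⟨ arcs-delete T x ⟩
      sum (λ v → indicator (T x v) + indicator (T v x)) + arcs (delete x T)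
        ≤⟨ +-monoˡ-≤ (arcs (delete x T)) (leaf-degree T oriented x y λ z z≢y j → isolated z (z≢y , j)) ⟩
      suc (arcs (delete x T))
        ≤⟨ s≤s (forest q (girthAbove-mono {A = A} (n≤1+n (suc q)) girth)
                       (f ∘ punchIn x) (Fin.punchIn-injective x _ _ ∘ f-inj)
                       (delete x T) (λ u v → oriented _ _) embeds) ⟩
      suc q ∎
    where open ≤-Reasoning
  ... | no  noLeaf = contradiction onward
        (some-leaf girth f f-inj (Joined T) [ embeds , adjacent-sym ∘ embeds ]′)
    where
    -- Finiteness and decidability turn the absence of a leaf into an actual choice of next
    -- vertices.
    onward : ∀ x y → ∃ λ z → z ≢ y × Joined T x z
    onward x y with Fin.any? (λ z → ¬? (z Fin.≟ y) ×-dec joined? T x z)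
    ... | yes found = found
    ... | no  none  = contradiction (x , y , λ z h → none (z , h)) noLeaf

-- Counting the edges of H

-- Unification is the only way to name the function row local to the definition of edges.
private
  rows : (G : Graph) →
         Σ (Fin (order G) → Fin (order G) → List (Fin (order G) × Fin (order G))) λ row →
         edges G ≡ concatMap (λ u → concatMap (row u) (allFin (order G))) (allFin (order G))
  rows G = _ , refl

increasing : (G : Graph) → Digraph (order G)
increasing G u v = (toℕ u <ᵇ toℕ v) ∧ adj G u v

increasing-sound : (G : Graph) → ∀ {u v} → increasing G u v ≡ true →
                   toℕ u < toℕ v × adj G u v ≡ true
increasing-sound G {u} {v} eq with toℕ u <ᵇ toℕ v in lt
... | true = <ᵇ⇒< _ _ (subst T (≡-sym lt) _) , eq

length-concatMap-tabulate : {A B : Set} (g : A → List B) (h : Fin n → A) →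
                            length (concatMap g (tabulate h)) ≡ sum (length ∘ g ∘ h)
length-concatMap-tabulate {zero}  g h = refl
length-concatMap-tabulate {suc n} g h = trans (List.length-++ (g (h zero)))
  (cong (λ r → length (g (h zero)) + r) (length-concatMap-tabulate g (h ∘ suc)))

numEdges-increasing : (G : Graph) → numEdges G ≡ arcs (increasing G)
numEdges-increasing G = trans
  (length-concatMap-tabulate (λ u → concatMap (proj₁ (rows G) u) (allFin (order G))) id)
  (sum-cong-≗ λ u →
    trans (length-concatMap-tabulate (proj₁ (rows G) u) id) (sum-cong-≗ (length-row u)))
  where
  length-row : ∀ u v → length (proj₁ (rows G) u v) ≡ indicator (increasing G u v)
  length-row u v with (toℕ u <ᵇ toℕ v) ∧ adj G u v
  ... | true  = refl
  ... | false = refl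

cyclomatic≥2⇒order<numEdges : (G : Graph) → + 2 ≤ℤ cyclomatic G → order G < numEdges G
-- Add the order minus 1 to both sides of the hypothesis.
cyclomatic≥2⇒order<numEdges G c = ℤ.drop‿+≤+ (subst (ℤ._≤ + numEdges G) (lower (+ order G))
    (subst (+ 2 ℤ.+ (+ order G ℤ.- + 1) ℤ.≤_) (upper (+ numEdges G) (+ order G))
      (ℤ.+-monoˡ-≤ (+ order G ℤ.- + 1) c)))
  where
  lower : ∀ p → + 2 ℤ.+ (p ℤ.- + 1) ≡ + 1 ℤ.+ p
  lower = ℤ-Ring.solve-∀
  upper : ∀ e p → ((e ℤ.- p) ℤ.+ + 1) ℤ.+ (p ℤ.- + 1) ≡ e
  upper = ℤ-Ring.solve-∀

-- The colouring

-- The bipartite double cover. Each of its edges has a unique end in the left copy, so pairs of a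
-- left vertex and a label name edges without a choice of representative.
double : Involutions X d → Involutions (X ⊎ X) d
double A = record
  { act        = λ i → [ inj₂ ∘ act A i , inj₁ ∘ act A i ]′
  ; involutive = λ { i (inj₁ x) → cong inj₁ (involutive A i x)
                   ; i (inj₂ x) → cong inj₂ (involutive A i x) }
  }

double-girthAbove : (A : Involutions X d) → ∀ {k} → GirthAbove A k → GirthAbove (double A) k
double-girthAbove A = girthAbove-pullback {A = double A} {A} {[ id , id ]′}
  λ { i (inj₁ x) → refl ; i (inj₂ x) → refl }

module Colour {n d : ℕ} (A : Involutions (Fin n) d) where

  -- Colour 0 is kept for non-edges, hence the `suc`. The label found by the search is the only one
  -- once the girth is above 2, by `act-injective`.
  crossColour : Fin n → Fin n → ℕ
  crossColour v v′ with Fin.any? (λ i → act A i v Fin.≟ v′)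
  ... | yes (i , _) = suc (toℕ (combine v i))
  ... | no  _       = 0

  sumColour : Fin n ⊎ Fin n → Fin n ⊎ Fin n → ℕ
  sumColour (inj₁ v)  (inj₁ v′) = 0
  sumColour (inj₁ v)  (inj₂ v′) = crossColour v v′
  sumColour (inj₂ v′) (inj₁ v)  = crossColour v v′
  sumColour (inj₂ v)  (inj₂ v′) = 0

  sumColour-sym : ∀ x y → sumColour x y ≡ sumColour y x
  sumColour-sym (inj₁ _) (inj₁ _) = refl
  sumColour-sym (inj₁ _) (inj₂ _) = refl
  sumColour-sym (inj₂ _) (inj₁ _) = refl
  sumColour-sym (inj₂ _) (inj₂ _) = refl

  crossColour≢0 : ∀ v v′ → crossColour v v′ ≢ 0 → Adjacent A v v′
  crossColour≢0 v v′ ≢0 with Fin.any? (λ i → act A i v Fin.≟ v′)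
  ... | yes adjacent = adjacent
  ... | no  _        = contradiction refl ≢0

  sumColour≢0 : ∀ x y → sumColour x y ≢ 0 → Adjacent (double A) x y
  sumColour≢0 (inj₁ _)  (inj₁ _)  ≢0 = contradiction refl ≢0
  sumColour≢0 (inj₁ v)  (inj₂ v′) ≢0 with crossColour≢0 v v′ ≢0
  ... | i , eq = i , cong inj₂ eq
  sumColour≢0 (inj₂ v′) (inj₁ v)  ≢0 with adjacent-sym A (crossColour≢0 v v′ ≢0)
  ... | i , eq = i , cong inj₁ eq
  sumColour≢0 (inj₂ _)  (inj₂ _)  ≢0 = contradiction refl ≢0

  colouring : Colouring (n + n)
  colouring = record
    { col    = λ i j → sumColour (splitAt n i) (splitAt n j)
    ; colSym = λ i j → sumColour-sym (splitAt n i) (splitAt n j)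
    }

  module _ {k} (2≤k : 2 ≤ k) (girth : GirthAbove A k) where

    crossColour-act : ∀ v i → crossColour v (act A i v) ≡ suc (toℕ (combine v i))
    crossColour-act v i with Fin.any? (λ j → act A j v Fin.≟ act A i v)
    ... | yes (j , eq) = cong (suc ∘ toℕ ∘ combine v) (act-injective A 2≤k girth v eq)
    ... | no  none     = contradiction (i , refl) none

    many-colours : ∀ {m} → m ≤ n * d → AtLeastColours colouring m
    many-colours {m} m≤nd = ends , distinct , λ r s eq → Fin.inject≤-injective _ _ r s
        (Fin.toℕ-injective (suc-injective (trans (≡-sym (colour r)) (trans eq (colour s)))))
      where
      index : Fin m → Fin (n * d)
      index r = Fin.inject≤ r m≤nd
      base : Fin m → Fin n
      base r = proj₁ (remQuot {n} d (index r))
      gen : Fin m → Fin d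
      gen r = proj₂ (remQuot {n} d (index r))
      ends : Fin m → Fin (n + n) × Fin (n + n)
      ends r = base r ↑ˡ n , n ↑ʳ act A (gen r) (base r)
      distinct : ∀ r → ¬ base r ↑ˡ n ≡ n ↑ʳ act A (gen r) (base r)
      distinct r eq
        with () ← trans (≡-sym (Fin.splitAt-↑ˡ n (base r) n))
                    (trans (cong (splitAt n) eq) (Fin.splitAt-↑ʳ n n _))
      colour : ∀ r → col colouring (proj₁ (ends r)) (proj₂ (ends r)) ≡ suc (toℕ (index r))
      colour r = trans
        (cong₂ sumColour (Fin.splitAt-↑ˡ n (base r) n) (Fin.splitAt-↑ʳ n n _))
        (trans (crossColour-act (base r) (gen r))
               (cong (suc ∘ toℕ) (Fin.combine-remQuot {n} d (index r))))

  splitAt-injective : ∀ {i j : Fin (n + n)} → splitAt n i ≡ splitAt n j → i ≡ j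
  splitAt-injective {i} {j} eq = trans (≡-sym (Fin.join-splitAt n n i))
    (trans (cong (Fin.join n n) eq) (Fin.join-splitAt n n j))

  -- The edges of non-zero colour embed in the double cover and form a forest, so there are at most
  -- `q` of them; the single possible edge of colour 0 raises the total only to `suc q`, the order
  -- of `H`.
  no-rainbow-copy : (H : Graph) → .{{NonZero (order H)}} → order H < numEdges H →
                    GirthAbove A (order H) → ¬ RainbowCopy H colouring
  no-rainbow-copy H@record { order = suc q } dense girth (f , f-inj , rainbow) = <⇒≱ dense (begin
      numEdges H         ≡⟨ numEdges-increasing H ⟩
      arcs D             ≤⟨ delete-arc D R unique ⟩
      suc (arcs R)       ≤⟨ s≤s (forest (double A) q (double-girthAbove A girth) (splitAt n ∘ f)
                              (f-inj ∘ splitAt-injective) R oriented embeds) ⟩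
      suc q              ∎)
    where
    open ≤-Reasoning
    colour : Fin (suc q) → Fin (suc q) → ℕ
    colour u v = col colouring (f u) (f v)
    D R : Digraph (suc q)
    D = increasing H
    R u v = D u v ∧ not (colour u v ≡ᵇ 0)
    R⇒D : ∀ u v → R u v ≡ true → D u v ≡ true
    R⇒D u v with D u v
    ... | true = λ _ → refl
    ... | false = id
    zeroColour : ∀ {u v} → D u v ≡ true → R u v ≢ true → colour u v ≡ 0
    zeroColour {u} {v} Duv ¬R with colour u v
    ... | zero = refl
    ... | suc _ = contradiction (trans (Bool.∧-identityʳ _) Duv) ¬R
    oriented : Oriented R
    oriented u v Ruv Rvu = <-asym (proj₁ (increasing-sound H (R⇒D u v Ruv)))
                                  (proj₁ (increasing-sound H (R⇒D v u Rvu)))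
    embeds : ∀ {u v} → R u v ≡ true → Adjacent (double A) (splitAt n (f u)) (splitAt n (f v))
    embeds {u} {v} Ruv = sumColour≢0 (splitAt n (f u)) (splitAt n (f v)) colour≢0
      where
      colour≢0 : colour u v ≢ 0
      colour≢0 eq with () ← trans (≡-sym Ruv)
        (trans (cong (λ c → D u v ∧ not (c ≡ᵇ 0)) eq) (Bool.∧-zeroʳ (D u v)))
    unique : ∀ {u v u′ v′} → D u v ≡ true → R u v ≢ true → D u′ v′ ≡ true → R u′ v′ ≢ true →
             u ≡ u′ × v ≡ v′
    unique {u} {v} {u′} {v′} Duv ¬R Duv′ ¬R′
      with increasing-sound H Duv | increasing-sound H Duv′
    ... | u<v , uv | u<v′ , uv′
      with rainbow u v u′ v′ uv uv′ (trans (zeroColour Duv ¬R) (≡-sym (zeroColour Duv′ ¬R′)))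
    ... | inj₁ same          = same
    -- Both arcs increase, so neither is the reverse of the other.
    ... | inj₂ (refl , refl) = contradiction u<v′ (<-asym u<v)

-- Rainbow numbers

-- For an undecided predicate a least element is available constructively only under double
-- negation, which suffices for deriving a contradiction.
¬¬-minimum : (P : ℕ → Set) → ∃ P → ¬ ¬ (∃ λ m → P m × (∀ k → P k → m ≤ k))
¬¬-minimum P (m , Pm) none = <-rec (¬_ ∘ P)
  (λ m rec Pm → none (m , Pm , λ k Pk → ≮⇒≥ λ k<m → rec k<m Pk)) m Pm

-- Holds vacuously, as there are only `n * n` ordered pairs to colour. It shows that some number of
-- colours forces `H`, so that a least one can be sought.
forces-many : ∀ H n → Forces H n (suc (n * n))
forces-many H n c (ends , _ , distinctColours)
  with Fin.pigeonhole (n<1+n (n * n)) (λ r → combine (proj₁ (ends r)) (proj₂ (ends r)))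
... | r , s , r<s , eq = contradiction
  (distinctColours r s (cong₂ (col c) (proj₁ (sameEnds eq)) (proj₂ (sameEnds eq))))
  (Fin.<⇒≢ r<s)
  where
  sameEnds = Fin.combine-injective (proj₁ (ends r)) (proj₂ (ends r)) (proj₁ (ends s)) (proj₂ (ends s))

theorem3 : (H : Graph) → 4 ≤ order H → Connected H → + 2 ≤ℤ cyclomatic H →
    ¬ (Σ ℕ λ a → Σ ℕ λ b → ∀ n → order H ≤ n → ∀ m → IsRb H n m → m ≤ a * n + b)
theorem3 H 4≤p _ cyc (a , b , bound)
  -- The double cover has `n + n` vertices and `n * d` edges, so `d` equal to `a + a + b` gives at
  -- least `a * (n + n) + b` colours. The last `order H` makes `n` large enough for `bound`.
  with large-girth (order H) (a + a + b) (order H) {{>-nonZero (≤-trans (s≤s z≤n) 4≤p)}}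
... | n , p≤n , A , girth =
  ¬¬-minimum (Forces H (n + n)) (_ , forces-many H (n + n)) λ (m , forces , least) →
    no-rainbow-copy H (cyclomatic≥2⇒order<numEdges H cyc) girth
      (forces colouring (many-colours (≤-trans (s≤s (s≤s z≤n)) 4≤p) girth (begin
        m                    ≤⟨ bound (n + n) (≤-trans p≤n (m≤m+n n n)) m (forces , least) ⟩
        a * (n + n) + b      ≤⟨ +-monoʳ-≤ (a * (n + n)) (m≤n*m b n) ⟩
        a * (n + n) + n * b  ≡⟨ regroup a b n ⟩
        n * (a + a + b)      ∎)))
  where
  open ≤-Reasoning
  open Colour A
  instance
    order≢0 : NonZero (order H)
    order≢0 = >-nonZero (≤-trans (s≤s z≤n) 4≤p)
    n≢0 : NonZero n
    n≢0 = >-nonZero (≤-trans (≤-trans (s≤s z≤n) 4≤p) p≤n)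
  regroup : ∀ a b n → a * (n + n) + n * b ≡ n * (a + a + b)
  regroup = ℕ-Ring.solve-∀
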